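{- Let $L,H$ be causal models in a Markov category $\mathcal C$ with sets of interventions $\mathcal I_L$ on $L$ and $\mathcal I_H$ on $H$. An exact transformation $(\tau,\omega)$ from $L$ to $H$ with intervention sets $\mathcal I_L,\mathcal I_H$ is equivalent to an upward abstraction $(\pi,\tau,\omega)\colon(\mathcal I_L^{\mathsf{io}},L)\to(\mathcal I_H^{\mathsf{io}},H)$.
   Context: **Categories.** A Markov category is a symmetric monoidal category with terminal unit $I$ in which each object has a commutative comonoid structure (copy, discard) compatible with $\otimes$. Morphisms are called channels; $f$ is deterministic if $\mathrm{copy}\circ f=(f\otimes f)\circ\mathrm{copy}$. **Causal models and interventions.** An open DAG is a finite DAG with vertex set $V$ and a subset $V^{\rm in}\subseteq V$ of parentless vertices (inputs); $V^{\rm nin}=V\setminus V^{\rm in}$. A causal model $M$ over it in $\mathcal C$ consists of an object of $\mathcal C$ (again written $X$) for each vertex $X$, a channel (mechanism) $c_X\colon\bigotimes_{Y\in\mathrm{Pa}(X)}Y\to X$ for each $X\in V^{\rm nin}$, and a subset $V^{\rm out}\subseteq V$ of outputs. A set of variables also denotes the tensor of the corresponding objects. $M^{\mathrm{io}}\colon V^{\rm in}\to V^{\rm out}$ is the channel obtained by wiring together, with copy maps, the mechanisms of all non-input variables having a directed path to $V^{\rm out}$, copying each output variable once more to form an output, and discarding inputs with no path to $V^{\rm out}$. An intervention $\sigma$ on $M$ specifies new mechanisms $c'_X$ (possibly with new parents, but introducing no directed cycles) for a subset of variables $X\in V^{\rm nin}$, yielding a new causal model $M_\sigma$ with the same variables,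 objects, inputs and outputs. **Exact transformation** from $L$ to $H$ with intervention sets $\mathcal I_L,\mathcal I_H$: a pair of epic deterministic channels $V_L^{\rm in}\to V_H^{\rm in}$ and $V_L^{\rm out}\to V_H^{\rm out}$, both written $\tau$ (or $\tau^{\rm in},\tau^{\rm out}$ to distinguish them), and a surjective partial function $\omega$ from $\mathcal I_L$ to $\mathcal I_H$, such that whenever $\omega$ is defined on $\sigma\in\mathcal I_L$, $\tau^{\rm out}\circ L_\sigma^{\mathrm{io}}=H_{\omega(\sigma)}^{\mathrm{io}}\circ\tau^{\rm in}$. **Query signatures and upward abstractions.** A query signature $Q$ is a set of types and a set of queries, each with finite lists of input and output types; a model of $Q$ in $\mathcal C$ assigns to each type an object and to each query a channel of the corresponding type, denoted $[\![-]\!]$. For a set $\mathcal I$ of interventions on $M$, the query signature $\mathcal I^{\mathsf{io}}$ has exactly two types $\mathsf{in},\mathsf{out}$ and a query $\sigma\colon\mathsf{in}\to\mathsf{out}$ for each $\sigma\in\mathcal I$, modelled by $[\![\mathsf{in}]\!]=V^{\rm in}$, $[\![\mathsf{out}]\!]=V^{\rm out}$, $[\![\sigma]\!]=M_\sigma^{\mathrm{io}}$. Write $\mathsf{in}_L,\mathsf{out}_L$ and $\mathsf{in}_H,\mathsf{out}_H$ for the types of $\mathcal I_L^{\mathsf{io}}$ and $\mathcal I_H^{\mathsf{io}}$. An upward abstraction $(\pi,\tau,\omega)\colon(Q_L,L)\to(Q_H,H)$ consists of: for each type $X$ of $Q_H$, a list $\pi(X)$ of types of $Q_L$ and an epic deterministic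 channel $\tau_X\colon[\![\pi(X)]\!]_L\to[\![X]\!]_H$ (extended to lists by concatenation and tensor product, all such products being required to be epic); and a partial surjective map $\omega$ from queries of $Q_L$ to queries of $Q_H$ such that whenever $\omega(q_L)=q_H\colon X\to Y$ is defined, $q_L$ has type $\pi(X)\to\pi(Y)$ and $\tau_Y\circ[\![q_L]\!]_L=[\![q_H]\!]_H\circ\tau_X$. In the claim, the map on types is $\pi(\mathsf{in}_H)=\mathsf{in}_L$, $\pi(\mathsf{out}_H)=\mathsf{out}_L$, with $\tau_{\mathsf{in}_H}=\tau^{\rm in}$, $\tau_{\mathsf{out}_H}=\tau^{\rm out}$.
   Formalization: Exact transformations need not have all tensor products of τ epic, so the equivalence is stated (1) with only products at inputs and outputs of queries required epic, and (2) with all products required epic, this condition being added to the exact transformation. -}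

module Defs where

open import Data.Fin.Base using (Fin)
import Data.Fin.Induction as FinInd
import Data.Fin.Properties as Fin
open import Data.Fin.Subset using (Subset; _∈_; _⊆_; ∁; Empty)
open import Data.Fin.Subset.Properties using (_∈?_; x∈p⇒x∉∁p; x∉p⇒x∈∁p)
open import Data.List.Base using (List; []; _∷_; [_]; _++_; filter; allFin; concatMap)
open import Data.List.Membership.Propositional using () renaming (_∈_ to _∈ˡ_; _∉_ to _∉ˡ_)
open import Data.List.Membership.Propositional.Properties using (∈-allFin; ∈-filter⁺; ∈-filter⁻)
open import Data.List.Relation.Binary.Subset.Propositional using () renaming (_⊆_ to _⊆ˡ_)
open import Data.List.Relation.Unary.All as All using (All; []; _∷_)
open import Data.List.Relation.Unary.Any using (here; there)
open import Data.Nat.Base using (ℕ)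
open import Data.Product.Base using (Σ-syntax; ∃-syntax; _×_; _,_; proj₂)
open import Data.Sum.Base using (_⊎_)
open import Function.Base using (id)
open import Induction.WellFounded using (WellFounded; Acc; acc)
open import Level using (Level; _⊔_; suc)
open import Relation.Binary.Construct.Closure.ReflexiveTransitive using (Star; ε; _◅_)
open import Relation.Binary.Construct.Closure.Transitive using (TransClosure; transitive)
  renaming ([_] to [_]⁺)
open import Relation.Binary.PropositionalEquality
  using (_≡_; refl; subst; subst₂; isEquivalence; resp₂)
open import Relation.Binary.Structures using (IsEquivalence)
open import Relation.Nullary using (¬_; Dec; yes; no; contradiction)
open import Relation.Unary using (Pred)

import Data.List.Membership.DecPropositional as DecMembership

private
  variable
    o ℓ e : Level

record Category (o ℓ e : Level) : Set (suc (o ⊔ ℓ ⊔ e)) where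
  infix  4 _≈_ _⇒_
  infixr 9 _∘_
  field
    Obj : Set o
    _⇒_ : Obj → Obj → Set ℓ
    _≈_ : ∀ {X Y} → X ⇒ Y → X ⇒ Y → Set e
    id⇒ : ∀ {X} → X ⇒ X
    _∘_ : ∀ {X Y Z} → Y ⇒ Z → X ⇒ Y → X ⇒ Z

    ≈-equiv   : ∀ {X Y} → IsEquivalence (_≈_ {X} {Y})
    ∘-resp-≈  : ∀ {X Y Z} {f f′ : Y ⇒ Z} {g g′ : X ⇒ Y} →
                f ≈ f′ → g ≈ g′ → f ∘ g ≈ f′ ∘ g′
    identityˡ : ∀ {X Y} {f : X ⇒ Y} → id⇒ ∘ f ≈ f
    identityʳ : ∀ {X Y} {f : X ⇒ Y} → f ∘ id⇒ ≈ f
    assoc     : ∀ {W X Y Z} {h : Y ⇒ Z} {g : X ⇒ Y} {f : W ⇒ X} →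
                (h ∘ g) ∘ f ≈ h ∘ (g ∘ f)

  Epic : ∀ {X Y} → X ⇒ Y → Set (o ⊔ ℓ ⊔ e)
  Epic {_} {Y} f = ∀ {Z} (g h : Y ⇒ Z) → g ∘ f ≈ h ∘ f → g ≈ h

record SymmetricMonoidalCategory (o ℓ e : Level) : Set (suc (o ⊔ ℓ ⊔ e)) where
  field
    category : Category o ℓ e
  open Category category public

  infixr 10 _⊗₀_ _⊗₁_
  field
    I    : Obj
    _⊗₀_ : Obj → Obj → Obj
    _⊗₁_ : ∀ {X X′ Y Y′} → X ⇒ X′ → Y ⇒ Y′ → X ⊗₀ Y ⇒ X′ ⊗₀ Y′

    ⊗-resp-≈ : ∀ {X X′ Y Y′} {f f′ : X ⇒ X′} {g g′ : Y ⇒ Y′} →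
               f ≈ f′ → g ≈ g′ → f ⊗₁ g ≈ f′ ⊗₁ g′
    ⊗-id     : ∀ {X Y} → id⇒ {X} ⊗₁ id⇒ {Y} ≈ id⇒
    ⊗-∘      : ∀ {X X′ X″ Y Y′ Y″} {f : X ⇒ X′} {f′ : X′ ⇒ X″} {g : Y ⇒ Y′} {g′ : Y′ ⇒ Y″} →
               (f′ ∘ f) ⊗₁ (g′ ∘ g) ≈ (f′ ⊗₁ g′) ∘ (f ⊗₁ g)

    λ⇒ : ∀ {X} → I ⊗₀ X ⇒ X
    λ⇐ : ∀ {X} → X ⇒ I ⊗₀ X
    ρ⇒ : ∀ {X} → X ⊗₀ I ⇒ X
    ρ⇐ : ∀ {X} → X ⇒ X ⊗₀ I
    α⇒ : ∀ {X Y Z} → (X ⊗₀ Y) ⊗₀ Z ⇒ X ⊗₀ (Y ⊗₀ Z)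
    α⇐ : ∀ {X Y Z} → X ⊗₀ (Y ⊗₀ Z) ⇒ (X ⊗₀ Y) ⊗₀ Z
    σ  : ∀ {X Y} → X ⊗₀ Y ⇒ Y ⊗₀ X

    λ-isoˡ : ∀ {X} → λ⇐ ∘ λ⇒ ≈ id⇒ {I ⊗₀ X}
    λ-isoʳ : ∀ {X} → λ⇒ ∘ λ⇐ ≈ id⇒ {X}
    ρ-isoˡ : ∀ {X} → ρ⇐ ∘ ρ⇒ ≈ id⇒ {X ⊗₀ I}
    ρ-isoʳ : ∀ {X} → ρ⇒ ∘ ρ⇐ ≈ id⇒ {X}
    α-isoˡ : ∀ {X Y Z} → α⇐ ∘ α⇒ ≈ id⇒ {(X ⊗₀ Y) ⊗₀ Z}
    α-isoʳ : ∀ {X Y Z} → α⇒ ∘ α⇐ ≈ id⇒ {X ⊗₀ (Y ⊗₀ Z)}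

    λ-natural : ∀ {X Y} {f : X ⇒ Y} → λ⇒ ∘ (id⇒ ⊗₁ f) ≈ f ∘ λ⇒
    ρ-natural : ∀ {X Y} {f : X ⇒ Y} → ρ⇒ ∘ (f ⊗₁ id⇒) ≈ f ∘ ρ⇒
    α-natural : ∀ {X X′ Y Y′ Z Z′} {f : X ⇒ X′} {g : Y ⇒ Y′} {h : Z ⇒ Z′} →
                α⇒ ∘ ((f ⊗₁ g) ⊗₁ h) ≈ (f ⊗₁ (g ⊗₁ h)) ∘ α⇒
    σ-natural : ∀ {X X′ Y Y′} {f : X ⇒ X′} {g : Y ⇒ Y′} →
                σ ∘ (f ⊗₁ g) ≈ (g ⊗₁ f) ∘ σ

    triangle  : ∀ {X Y} → (id⇒ ⊗₁ λ⇒) ∘ α⇒ ≈ ρ⇒ {X} ⊗₁ id⇒ {Y}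
    pentagon  : ∀ {W X Y Z} →
                (id⇒ ⊗₁ α⇒) ∘ α⇒ ∘ (α⇒ ⊗₁ id⇒) ≈ α⇒ ∘ α⇒ {W ⊗₀ X} {Y} {Z}
    hexagon   : ∀ {X Y Z} →
                (id⇒ ⊗₁ σ) ∘ α⇒ ∘ (σ ⊗₁ id⇒) ≈ α⇒ ∘ σ ∘ α⇒ {X} {Y} {Z}
    symmetric : ∀ {X Y} → σ ∘ σ ≈ id⇒ {X ⊗₀ Y}

  middleSwap : ∀ {W X Y Z} → (W ⊗₀ X) ⊗₀ (Y ⊗₀ Z) ⇒ (W ⊗₀ Y) ⊗₀ (X ⊗₀ Z)
  middleSwap = α⇐ ∘ (id⇒ ⊗₁ (α⇒ ∘ (σ ⊗₁ id⇒) ∘ α⇐)) ∘ α⇒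

record MarkovCategory (o ℓ e : Level) : Set (suc (o ⊔ ℓ ⊔ e)) where
  field
    symmetricMonoidal : SymmetricMonoidalCategory o ℓ e
  open SymmetricMonoidalCategory symmetricMonoidal public

  -- Terminality of I makes discard natural and compatible with ⊗ and I;
  -- copy {I} ≈ λ⇐ then follows from the counit law.
  field
    discard        : ∀ {X} → X ⇒ I
    discard-unique : ∀ {X} (f : X ⇒ I) → f ≈ discard

    copy        : ∀ {X} → X ⇒ X ⊗₀ X
    copy-assoc  : ∀ {X} → α⇒ ∘ (copy ⊗₁ id⇒) ∘ copy ≈ (id⇒ ⊗₁ copy) ∘ copy {X}
    copy-comm   : ∀ {X} → σ ∘ copy ≈ copy {X}
    copy-unitˡ  : ∀ {X} → λ⇒ ∘ (discard ⊗₁ id⇒) ∘ copy ≈ id⇒ {X}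
    copy-unitʳ  : ∀ {X} → ρ⇒ ∘ (id⇒ ⊗₁ discard) ∘ copy ≈ id⇒ {X}
    copy-⊗      : ∀ {X Y} → copy {X ⊗₀ Y} ≈ middleSwap ∘ (copy ⊗₁ copy)

  Deterministic : ∀ {X Y} → X ⇒ Y → Set e
  Deterministic f = copy ∘ f ≈ (f ⊗₁ f) ∘ copy

module ListTensor (𝓒 : MarkovCategory o ℓ e) {a : Level} {A : Set a}
                  (obj : A → MarkovCategory.Obj 𝓒) where
  open MarkovCategory 𝓒

  -- The product of a one-element list is the object itself, not X ⊗ I.
  ⨂ : List A → Obj
  ⨂ []           = I
  ⨂ (x ∷ [])     = obj x
  ⨂ (x ∷ y ∷ xs) = obj x ⊗₀ ⨂ (y ∷ xs)

  cons : ∀ x xs → obj x ⊗₀ ⨂ xs ⇒ ⨂ (x ∷ xs)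
  cons x []       = ρ⇒
  cons x (_ ∷ _)  = id⇒

  uncons : ∀ x xs → ⨂ (x ∷ xs) ⇒ obj x ⊗₀ ⨂ xs
  uncons x []      = ρ⇐
  uncons x (_ ∷ _) = id⇒

  split : ∀ xs ys → ⨂ (xs ++ ys) ⇒ ⨂ xs ⊗₀ ⨂ ys
  split []       ys = λ⇐
  split (x ∷ xs) ys =
    (cons x xs ⊗₁ id⇒) ∘ α⇐ ∘ (id⇒ ⊗₁ split xs ys) ∘ uncons x (xs ++ ys)

  project : ∀ {x xs} → x ∈ˡ xs → ⨂ xs ⇒ obj x
  project {xs = x ∷ xs} (here refl) = ρ⇒ ∘ (id⇒ ⊗₁ discard) ∘ uncons x xs
  project {xs = x ∷ xs} (there x∈)  = λ⇒ ∘ (discard ⊗₁ project x∈) ∘ uncons x xs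

  -- Copies each wire as often as it is listed in ys and discards the others.
  select : ∀ {xs} ys → All (_∈ˡ xs) ys → ⨂ xs ⇒ ⨂ ys
  select []       []         = discard
  select (y ∷ ys) (y∈ ∷ ys∈) = cons y ys ∘ (project y∈ ⊗₁ select ys ys∈) ∘ copy

-- The order of Fin n also fixes the order of the factors in the tensor product
-- of a set of variables.
elements : ∀ {n} → Subset n → List (Fin n)
elements {n} p = filter (_∈? p) (allFin n)

Edge : ∀ {n} → (Fin n → Subset n) → Fin n → Fin n → Set
Edge parents Y X = Y ∈ parents X

Acyclic : ∀ {n} → (Fin n → Subset n) → Set
Acyclic parents = ∀ {X} → ¬ TransClosure (Edge parents) X X

override : ∀ {n} {p : Subset n} →
           (∀ {X} → X ∈ p → Subset n) → (Fin n → Subset n) → ∀ {X} → Dec (X ∈ p) → Subset n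
override new old     (yes X∈) = new X∈
override new old {X} (no  _)  = old X

record OpenDAG : Set where
  field
    n           : ℕ
    parents     : Fin n → Subset n
    acyclic     : Acyclic parents
    inputs      : Subset n
    parentless  : ∀ {X} → X ∈ inputs → Empty (parents X)

  V : Set
  V = Fin n

  nonInputs : Subset n
  nonInputs = ∁ inputs

  Path⁺ : V → V → Set
  Path⁺ = TransClosure (Edge parents)

  ancestor-wellFounded : WellFounded Path⁺
  ancestor-wellFounded = FinInd.spo-wellFounded record
    { isEquivalence = isEquivalence
    ; irrefl        = λ { refl → acyclic }
    ; trans         = transitive _
    ; <-resp-≈      = resp₂ _
    }

module _ (𝓒 : MarkovCategory o ℓ e) where
  open MarkovCategory 𝓒

  record CausalModel : Set (o ⊔ ℓ) where
    field
      graph : OpenDAG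
    open OpenDAG graph public
    field
      obj : V → Obj
    open ListTensor 𝓒 obj public
    field
      mechanism : ∀ {X} → X ∈ nonInputs → ⨂ (elements (parents X)) ⇒ obj X
      outputs   : Subset n

    ⟦_⟧ˢ : Subset n → Obj
    ⟦ p ⟧ˢ = ⨂ (elements p)

    Relevant : V → Set
    Relevant X = ∃[ Y ] Y ∈ outputs × Star (Edge parents) X Y

    -- An order in which to draw the boxes of the diagram M^io.  A value of
    -- Schedule Γ starts from the input wires and draws, each at most once and
    -- after its parents, the non-input variables occurring in Γ.
    data Schedule : List V → Set where
      start : Schedule (elements inputs)
      draw  : ∀ {Γ X} → Schedule Γ → X ∈ nonInputs → Relevant X → X ∉ˡ Γ →
              All (_∈ˡ Γ) (elements (parents X)) → Schedule (X ∷ Γ)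

    -- Copying all of Γ and discarding the copies that a mechanism does not use
    -- agrees, by the counit laws, with copying just the wires it uses.
    diagram : ∀ {Γ} → Schedule Γ → ⟦ inputs ⟧ˢ ⇒ ⨂ Γ
    diagram start = id⇒
    diagram (draw {Γ} {X} s X∈ _ _ pa⊆Γ) =
      cons X Γ ∘ (mechanism X∈ ⊗₁ id⇒) ∘ (select (elements (parents X)) pa⊆Γ ⊗₁ id⇒)
        ∘ copy ∘ diagram s

    private
      open DecMembership (Fin._≟_ {n}) using () renaming (_∈?_ to _∈ˡ?_)

      Extension : List V → (List V → Set) → Set
      Extension Γ P = Σ[ Γ′ ∈ List V ] Schedule Γ′ × Γ ⊆ˡ Γ′ × P Γ′

      inputs⊆ : ∀ {Γ X} → Schedule Γ → X ∈ inputs → X ∈ˡ Γ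
      inputs⊆ start            X∈ = ∈-filter⁺ (_∈? inputs) (∈-allFin _) X∈
      inputs⊆ (draw s _ _ _ _) X∈ = there (inputs⊆ s X∈)

      -- Depth-first search backwards from the outputs.
      visitAll : ∀ Δ →
                 (∀ {Γ Y} → Y ∈ˡ Δ → Schedule Γ → Extension Γ (Y ∈ˡ_)) →
                 ∀ {Γ} → Schedule Γ → Extension Γ (λ Γ′ → All (_∈ˡ Γ′) Δ)
      visitAll []      visit s = _ , s , id , []
      visitAll (Y ∷ Δ) visit s =
        let Γ₁ , s₁ , Γ⊆Γ₁  , Y∈ = visit (here refl) s
            Γ₂ , s₂ , Γ₁⊆Γ₂ , Δ∈ = visitAll Δ (λ Z∈ → visit (there Z∈)) s₁
        in  Γ₂ , s₂ , (λ Z∈ → Γ₁⊆Γ₂ (Γ⊆Γ₁ Z∈)) , Γ₁⊆Γ₂ Y∈ ∷ Δ∈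

      visit : ∀ {Γ} X → Acc Path⁺ X → Relevant X → Schedule Γ → Extension Γ (X ∈ˡ_)
      visit {Γ} X (acc rs) (O , O∈ , X⟶*O) s with X ∈ˡ? Γ
      ... | yes X∈ = Γ , s , id , X∈
      ... | no  X∉ with visitAll (elements (parents X))
              (λ Y∈ → let Y⟶X = proj₂ (∈-filter⁻ (_∈? parents X) {xs = allFin n} Y∈)
                      in  visit _ (rs [ Y⟶X ]⁺) (O , O∈ , Y⟶X ◅ X⟶*O))
              s
      ...   | Γ′ , s′ , Γ⊆Γ′ , pa∈ with X ∈ˡ? Γ′
      -- Excluded by acyclicity, but it is simpler to answer than to refute.
      ...     | yes X∈  = Γ′ , s′ , Γ⊆Γ′ , X∈
      ...     | no  X∉′ =
        X ∷ Γ′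
        , draw s′ (x∉p⇒x∈∁p (λ X∈in → X∉ (inputs⊆ s X∈in))) (O , O∈ , X⟶*O) X∉′ pa∈
        , (λ Z∈ → there (Γ⊆Γ′ Z∈))
        , here refl

    schedule : Σ[ Γ ∈ List V ] Schedule Γ × All (_∈ˡ Γ) (elements outputs)
    schedule =
      let Γ , s , _ , out∈ = visitAll (elements outputs)
            (λ {_} {Y} Y∈ → visit Y (ancestor-wellFounded Y)
              (Y , proj₂ (∈-filter⁻ (_∈? outputs) {xs = allFin n} Y∈) , ε))
            start
      in  Γ , s , out∈

    io : ⟦ inputs ⟧ˢ ⇒ ⟦ outputs ⟧ˢ
    io = let _ , s , out∈ = schedule in select (elements outputs) out∈ ∘ diagram s

  module _ (M : CausalModel) where
    open CausalModel M

    record Intervention : Set ℓ where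
      field
        targets      : Subset n
        targets⊆nin  : targets ⊆ nonInputs
        newParents   : ∀ {X} → X ∈ targets → Subset n
        newMechanism : ∀ {X} (X∈ : X ∈ targets) → ⟦ newParents X∈ ⟧ˢ ⇒ obj X
        acyclic′     : Acyclic (λ X → override newParents parents (X ∈? targets))

  intervene : (M : CausalModel) → Intervention M → CausalModel
  intervene M ι = record
    { graph = record
      { n          = n
      ; parents    = λ X → override newParents parents (X ∈? targets)
      ; acyclic    = acyclic′
      ; inputs     = inputs
      ; parentless = λ {X} X∈ → parentless′ X∈ (X ∈? targets)
      }
    ; obj       = obj
    ; mechanism = λ {X} X∈ → mechanism′ X∈ (X ∈? targets)
    ; outputs   = outputs
    }
    where
    open CausalModel M
    open Intervention ι

    parentless′ : ∀ {X} → X ∈ inputs → (d : Dec (X ∈ targets)) →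
                  Empty (override newParents parents d)
    parentless′ X∈ (yes X∈t) = contradiction (targets⊆nin X∈t) (x∈p⇒x∉∁p X∈)
    parentless′ X∈ (no  _)   = parentless X∈

    mechanism′ : ∀ {X} → X ∈ nonInputs → (d : Dec (X ∈ targets)) →
                 ⟦ override newParents parents d ⟧ˢ ⇒ obj X
    mechanism′ X∈ (yes X∈t) = newMechanism X∈t
    mechanism′ X∈ (no  _)   = mechanism X∈

  -- A set of interventions is given as a family indexed by an arbitrary set; a
  -- predicate P on interventions is the family proj₁ indexed by ∃ P.
  record Interventions (i : Level) (M : CausalModel) : Set (ℓ ⊔ suc i) where
    field
      Index : Set i
      at    : Index → Intervention M

    io[_] : Index → CausalModel.⟦_⟧ˢ M (CausalModel.inputs M)
                  ⇒ CausalModel.⟦_⟧ˢ M (CausalModel.outputs M)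
    io[ s ] = CausalModel.io (intervene M (at s))

-- Not A → Maybe B, which would force the domain of definition to be decidable.
record PartialFunction {a b} (A : Set a) (B : Set b) (r : Level) : Set (a ⊔ b ⊔ suc r) where
  infix 4 _↦_
  field
    _↦_        : A → B → Set r
    functional : ∀ {x y y′} → x ↦ y → x ↦ y′ → y ≡ y′

  Surjective : Set (a ⊔ b ⊔ r)
  Surjective = ∀ y → ∃[ x ] x ↦ y

module _ (𝓒 : MarkovCategory o ℓ e) where
  open MarkovCategory 𝓒

  module _ {L H : CausalModel 𝓒} {i j r : Level} where
    private
      module L = CausalModel L
      module H = CausalModel H

    record IsExactTransformation
             (𝓘L : Interventions 𝓒 i L) (𝓘H : Interventions 𝓒 j H)
             (τ-in  : L.⟦ L.inputs ⟧ˢ ⇒ H.⟦ H.inputs ⟧ˢ)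
             (τ-out : L.⟦ L.outputs ⟧ˢ ⇒ H.⟦ H.outputs ⟧ˢ)
             (ω : PartialFunction (Interventions.Index 𝓘L) (Interventions.Index 𝓘H) r)
             : Set (o ⊔ ℓ ⊔ e ⊔ i ⊔ j ⊔ r) where
      private
        module 𝓘L = Interventions 𝓘L
        module 𝓘H = Interventions 𝓘H
      open PartialFunction ω
      field
        τ-in-epic           : Epic τ-in
        τ-in-deterministic  : Deterministic τ-in
        τ-out-epic          : Epic τ-out
        τ-out-deterministic : Deterministic τ-out
        ω-surjective        : Surjective
        exact               : ∀ {s t} → s ↦ t → τ-out ∘ 𝓘L.io[ s ] ≈ 𝓘H.io[ t ] ∘ τ-in

record QuerySignature (t q : Level) : Set (suc (t ⊔ q)) where
  field
    Type  : Set t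
    Query : Set q
    dom   : Query → List Type
    cod   : Query → List Type

Interface : ∀ {t q} (Q : QuerySignature t q) → Pred (List (QuerySignature.Type Q)) (t ⊔ q)
Interface Q Xs = ∃[ q ] (Xs ≡ dom q ⊎ Xs ≡ cod q)
  where open QuerySignature Q

module _ (𝓒 : MarkovCategory o ℓ e) where
  open MarkovCategory 𝓒

  record Model {t q} (Q : QuerySignature t q) : Set (o ⊔ ℓ ⊔ t ⊔ q) where
    open QuerySignature Q
    field
      ⟦_⟧ᵗ : Type → Obj
    open ListTensor 𝓒 ⟦_⟧ᵗ public
    field
      ⟦_⟧ : (q : Query) → ⨂ (dom q) ⇒ ⨂ (cod q)

  module _ {t q t′ q′ : Level} {QL : QuerySignature t q} {QH : QuerySignature t′ q′}
           (L : Model QL) (H : Model QH) where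
    private
      module QL = QuerySignature QL
      module QH = QuerySignature QH
      module L = Model L
      module H = Model H

    extend : (π : QH.Type → List QL.Type) →
             (∀ X → L.⨂ (π X) ⇒ H.⟦ X ⟧ᵗ) →
             ∀ Xs → L.⨂ (concatMap π Xs) ⇒ H.⨂ Xs
    extend π τ []       = id⇒
    extend π τ (X ∷ Xs) =
      H.cons X Xs ∘ (τ X ⊗₁ extend π τ Xs) ∘ L.split (π X) (concatMap π Xs)

    -- 𝓔 is the class of lists Xs of types for which extend π τ Xs, the product
    -- of the τ X, is required to be epic.  Epics need not be closed under ⊗, so
    -- 𝓔 = U (all lists) asks for more than 𝓔 = Interface QH (the lists that
    -- are the inputs or outputs of a query).
    record IsUpwardAbstraction {k r}
             (𝓔 : Pred (List QH.Type) k)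
             (π : QH.Type → List QL.Type)
             (τ : ∀ X → L.⨂ (π X) ⇒ H.⟦ X ⟧ᵗ)
             (ω : PartialFunction QL.Query QH.Query r)
             : Set (o ⊔ ℓ ⊔ e ⊔ t ⊔ t′ ⊔ q ⊔ q′ ⊔ k ⊔ r) where
      open PartialFunction ω
      field
        τ-epic          : ∀ X → Epic (τ X)
        τ-deterministic : ∀ X → Deterministic (τ X)
        products-epic   : ∀ Xs → 𝓔 Xs → Epic (extend π τ Xs)
        ω-surjective    : Surjective
        ω-dom           : ∀ {p q} → p ↦ q → QL.dom p ≡ concatMap π (QH.dom q)
        ω-cod           : ∀ {p q} → p ↦ q → QL.cod p ≡ concatMap π (QH.cod q)
        natural         : ∀ {p q} (p↦q : p ↦ q) →
          extend π τ (QH.cod q) ∘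
            subst₂ (λ Xs Ys → L.⨂ Xs ⇒ L.⨂ Ys) (ω-dom p↦q) (ω-cod p↦q) L.⟦ p ⟧
          ≈ H.⟦ q ⟧ ∘ extend π τ (QH.dom q)

data IOType : Set where
  input output : IOType

module _ {𝓒 : MarkovCategory o ℓ e} {i : Level} {M : CausalModel 𝓒} (𝓘 : Interventions 𝓒 i M) where
  open CausalModel M

  ioSignature : QuerySignature Level.zero i
  ioSignature = record
    { Type  = IOType
    ; Query = Interventions.Index 𝓘
    ; dom   = λ _ → [ input ]
    ; cod   = λ _ → [ output ]
    }

  ioModel : Model 𝓒 ioSignature
  ioModel = record
    { ⟦_⟧ᵗ = λ { input → ⟦ inputs ⟧ˢ ; output → ⟦ outputs ⟧ˢ }
    ; ⟦_⟧  = Interventions.io[_] 𝓘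
    }

ioπ : IOType → List IOType
ioπ input  = [ input ]
ioπ output = [ output ]

module _ {𝓒 : MarkovCategory o ℓ e} {i j : Level} {L H : CausalModel 𝓒}
         (𝓘L : Interventions 𝓒 i L) (𝓘H : Interventions 𝓒 j H) where
  open MarkovCategory 𝓒
  private
    module L = CausalModel L
    module H = CausalModel H

  ioτ : L.⟦ L.inputs ⟧ˢ ⇒ H.⟦ H.inputs ⟧ˢ → L.⟦ L.outputs ⟧ˢ ⇒ H.⟦ H.outputs ⟧ˢ →
        ∀ X → Model.⨂ (ioModel 𝓘L) (ioπ X) ⇒ Model.⟦_⟧ᵗ (ioModel 𝓘H) X
  ioτ τ-in τ-out input  = τ-in
  ioτ τ-in τ-out output = τ-out

{-# OPTIONS --safe #-}
module Submission where

open import Defs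
open import Data.List.Base using ([]; [_])
open import Data.Product.Base using (_×_; _,_)
open import Data.Sum.Base using (inj₁; inj₂)
open import Function.Bundles using (_⇔_; mk⇔)
open import Level using (Level)
open import Relation.Binary.Bundles using (Setoid)
open import Relation.Binary.PropositionalEquality as ≡ using (_≡_; refl; subst₂)
open import Relation.Binary.Structures using (IsEquivalence)
open import Relation.Unary using (U; Pred)

import Relation.Binary.Reasoning.Setoid as SetoidReasoning

-- All interfaces of 𝓘^io are one-element lists, on which the extension of τ to
-- lists is τ itself: the associator and unitors that split a one-element list
-- cancel by the triangle identity and naturality of ρ.  Hence the conditions of
-- the two notions agree one by one.

module CategoryProperties {o ℓ e} (𝓒 : Category o ℓ e) where
  open Category 𝓒

  module _ {X Y : Obj} where
    open IsEquivalence (≈-equiv {X} {Y}) public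
      renaming (refl to ≈-refl; sym to ≈-sym; trans to ≈-trans; reflexive to ≈-reflexive)

    hom-setoid : Setoid ℓ e
    hom-setoid = record { isEquivalence = ≈-equiv {X} {Y} }

  ∘-respˡ : ∀ {X Y Z} {f f′ : Y ⇒ Z} {g : X ⇒ Y} → f ≈ f′ → f ∘ g ≈ f′ ∘ g
  ∘-respˡ f≈f′ = ∘-resp-≈ f≈f′ ≈-refl

  ∘-respʳ : ∀ {X Y Z} {f : Y ⇒ Z} {g g′ : X ⇒ Y} → g ≈ g′ → f ∘ g ≈ f ∘ g′
  ∘-respʳ = ∘-resp-≈ ≈-refl

  cancelʳ : ∀ {X Y Z} {f : Y ⇒ Z} {g : X ⇒ Y} {h : Y ⇒ X} →
            g ∘ h ≈ id⇒ → (f ∘ g) ∘ h ≈ f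
  cancelʳ gh≈id = ≈-trans assoc (≈-trans (∘-respʳ gh≈id) identityʳ)

  Epic-resp-≈ : ∀ {X Y} {f f′ : X ⇒ Y} → f ≈ f′ → Epic f → Epic f′
  Epic-resp-≈ f≈f′ f-epic g h gf′≈hf′ = f-epic g h
    (≈-trans (∘-respʳ f≈f′) (≈-trans gf′≈hf′ (∘-respʳ (≈-sym f≈f′))))

module SingletonTensor {o ℓ e} (𝓒 : MarkovCategory o ℓ e) {a} {A : Set a}
                       (obj : A → MarkovCategory.Obj 𝓒) where
  open MarkovCategory 𝓒
  open ListTensor 𝓒 obj
  open CategoryProperties category

  -- The right-hand list is empty because `concatMap ioπ [ X ]` ends in `[]`. Both `cons` and
  -- `uncons` are then unitors, since the product of a one-element list is the object itself.
  split-[_]-[] : ∀ x → split [ x ] [] ≈ ρ⇐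
  split-[ x ]-[] = begin
    (ρ⇒ ⊗₁ id⇒) ∘ α⇐ ∘ (id⇒ ⊗₁ λ⇐) ∘ ρ⇐              ≈⟨ assoc ⟨
    -- The triangle identity, read backwards, trades `ρ⇒ ⊗₁ id⇒` for a composite ending in `α⇒`,
    -- which meets its inverse.
    ((ρ⇒ ⊗₁ id⇒) ∘ α⇐) ∘ (id⇒ ⊗₁ λ⇐) ∘ ρ⇐            ≈⟨ ∘-respˡ (∘-respˡ triangle) ⟨
    (((id⇒ ⊗₁ λ⇒) ∘ α⇒) ∘ α⇐) ∘ (id⇒ ⊗₁ λ⇐) ∘ ρ⇐     ≈⟨ ∘-respˡ (cancelʳ α-isoʳ) ⟩
    (id⇒ ⊗₁ λ⇒) ∘ (id⇒ ⊗₁ λ⇐) ∘ ρ⇐                   ≈⟨ assoc ⟨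
    ((id⇒ ⊗₁ λ⇒) ∘ (id⇒ ⊗₁ λ⇐)) ∘ ρ⇐                 ≈⟨ ∘-respˡ ⊗-∘ ⟨
    ((id⇒ ∘ id⇒) ⊗₁ (λ⇒ ∘ λ⇐)) ∘ ρ⇐                  ≈⟨ ∘-respˡ (⊗-resp-≈ identityˡ λ-isoʳ) ⟩
    (id⇒ ⊗₁ id⇒) ∘ ρ⇐                                ≈⟨ ∘-respˡ ⊗-id ⟩
    id⇒ ∘ ρ⇐                                         ≈⟨ identityˡ ⟩
    ρ⇐                                               ∎
    where open SetoidReasoning hom-setoid

  -- The left-hand side is what `extend` unfolds to on a one-element list whose type is sent to
  -- `[ x ]`, with `f` as the component of `τ`.
  ρ-split : ∀ x {Z} (f : obj x ⇒ Z) → ρ⇒ ∘ (f ⊗₁ id⇒) ∘ split [ x ] [] ≈ f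
  ρ-split x f = begin
    ρ⇒ ∘ (f ⊗₁ id⇒) ∘ split [ x ] []  ≈⟨ ∘-respʳ (∘-respʳ split-[ x ]-[]) ⟩
    ρ⇒ ∘ (f ⊗₁ id⇒) ∘ ρ⇐              ≈⟨ assoc ⟨
    (ρ⇒ ∘ (f ⊗₁ id⇒)) ∘ ρ⇐            ≈⟨ ∘-respˡ ρ-natural ⟩
    (f ∘ ρ⇒) ∘ ρ⇐                     ≈⟨ cancelʳ ρ-isoʳ ⟩
    f                                 ∎
    where open SetoidReasoning hom-setoid

-- In a given upward abstraction `ω-dom` and `ω-cod` are arbitrary proofs of `[ input ] ≡ [ input ]`
-- and `[ output ] ≡ [ output ]`. Axiom K makes them `refl`, so the transport in `natural` is
-- trivial.
subst₂-loops : ∀ {a b r} {A : Set a} {B : Set b} (R : A → B → Set r) {x y}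
               (p : x ≡ x) (q : y ≡ y) (u : R x y) → subst₂ R p q u ≡ u
subst₂-loops R refl refl u = refl

module _ {o ℓ e i j} {𝓒 : MarkovCategory o ℓ e} {L H : CausalModel 𝓒}
         (𝓘L : Interventions 𝓒 i L) (𝓘H : Interventions 𝓒 j H) where
  open MarkovCategory 𝓒
  open CategoryProperties category
  private
    module L = CausalModel L
    module H = CausalModel H
    module 𝓘L = Interventions 𝓘L
    module 𝓘H = Interventions 𝓘H
    Lio = ioModel 𝓘L
    Hio = ioModel 𝓘H
    module Lio = Model Lio

  module _ (τ-in  : L.⟦ L.inputs ⟧ˢ ⇒ H.⟦ H.inputs ⟧ˢ)
           (τ-out : L.⟦ L.outputs ⟧ˢ ⇒ H.⟦ H.outputs ⟧ˢ) where
    private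
      τ = ioτ 𝓘L 𝓘H τ-in τ-out
      extendτ = extend 𝓒 Lio Hio ioπ τ

    extend-input : extendτ [ input ] ≈ τ-in
    extend-input = SingletonTensor.ρ-split 𝓒 Lio.⟦_⟧ᵗ input τ-in

    extend-output : extendτ [ output ] ≈ τ-out
    extend-output = SingletonTensor.ρ-split 𝓒 Lio.⟦_⟧ᵗ output τ-out

    -- Every query goes from `[ input ]` to `[ output ]`, so these are the only interfaces, and
    -- epicness passes along `≈`.
    extend-interface-epic : Epic τ-in → Epic τ-out →
      ∀ Xs → Interface (ioSignature 𝓘H) Xs → Epic (extendτ Xs)
    extend-interface-epic in-epic out-epic _ (_ , inj₁ refl) =
      Epic-resp-≈ (≈-sym extend-input) in-epic
    extend-interface-epic in-epic out-epic _ (_ , inj₂ refl) =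
      Epic-resp-≈ (≈-sym extend-output) out-epic

    module _ {r} (ω : PartialFunction 𝓘L.Index 𝓘H.Index r) where
      private
        Exact = IsExactTransformation 𝓒 𝓘L 𝓘H τ-in τ-out ω

      -- Keeping `𝓔` abstract serves both readings of the epicness condition. It is a separate
      -- premise because epics need not be closed under `⊗₁`.
      exact⇒upward : ∀ {k} {𝓔 : Pred _ k} → (∀ Xs → 𝓔 Xs → Epic (extendτ Xs)) →
                     Exact → IsUpwardAbstraction 𝓒 Lio Hio 𝓔 ioπ τ ω
      exact⇒upward products-epic E = record
        { τ-epic          = λ { input → τ-in-epic ; output → τ-out-epic }
        ; τ-deterministic = λ { input → τ-in-deterministic ; output → τ-out-deterministic }
        ; products-epic   = products-epic
        ; ω-surjective    = ω-surjective
        ; ω-dom           = λ _ → refl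
        ; ω-cod           = λ _ → refl
        -- With `refl` chosen for `ω-dom` and `ω-cod`, the `subst₂` computes away.
        ; natural         = λ s↦t → ≈-trans (∘-respˡ extend-output)
            (≈-trans (exact s↦t) (∘-respʳ (≈-sym extend-input)))
        }
        where open IsExactTransformation E

      upward⇒exact : ∀ {k} {𝓔 : Pred _ k} →
                     IsUpwardAbstraction 𝓒 Lio Hio 𝓔 ioπ τ ω → Exact
      upward⇒exact A = record
        { τ-in-epic           = τ-epic input
        ; τ-in-deterministic  = τ-deterministic input
        ; τ-out-epic          = τ-epic output
        ; τ-out-deterministic = τ-deterministic output
        ; ω-surjective        = ω-surjective
        ; exact               = λ {s} {t} s↦t →
            let transported = subst₂-loops (λ Xs Ys → Lio.⨂ Xs ⇒ Lio.⨂ Ys)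
                                (ω-dom s↦t) (ω-cod s↦t) 𝓘L.io[ s ]
            in  ≈-trans (∘-resp-≈ (≈-sym extend-output) (≈-reflexive (≡.sym transported)))
                  (≈-trans (natural s↦t) (∘-respʳ extend-input))
        }
        where open IsUpwardAbstraction A

proposition22 :
  ∀ {o ℓ e i j r : Level} (𝓒 : MarkovCategory o ℓ e) (L H : CausalModel 𝓒)
    (𝓘L : Interventions 𝓒 i L) (𝓘H : Interventions 𝓒 j H) →
    let open MarkovCategory 𝓒
        module L = CausalModel L
        module H = CausalModel H
        Lio = ioModel 𝓘L
        Hio = ioModel 𝓘H
    in
    (τ-in  : L.⟦ L.inputs ⟧ˢ ⇒ H.⟦ H.inputs ⟧ˢ)
    (τ-out : L.⟦ L.outputs ⟧ˢ ⇒ H.⟦ H.outputs ⟧ˢ)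
    (ω : PartialFunction (Interventions.Index 𝓘L) (Interventions.Index 𝓘H) r) →
    let τ = ioτ 𝓘L 𝓘H τ-in τ-out
        Exact = IsExactTransformation 𝓒 𝓘L 𝓘H τ-in τ-out ω
    in
    -- products required to be epic: those at the interfaces of queries
    (Exact ⇔ IsUpwardAbstraction 𝓒 Lio Hio (Interface (ioSignature 𝓘H)) ioπ τ ω)
    ×
    -- products required to be epic: all finite ones
    ((Exact × (∀ Xs → Epic (extend 𝓒 Lio Hio ioπ τ Xs)))
      ⇔ IsUpwardAbstraction 𝓒 Lio Hio U ioπ τ ω)
proposition22 𝓒 L H 𝓘L 𝓘H τ-in τ-out ω =
    mk⇔ (λ E → let open IsExactTransformation E in
           exact⇒upward 𝓘L 𝓘H τ-in τ-out ω
             (extend-interface-epic 𝓘L 𝓘H τ-in τ-out τ-in-epic τ-out-epic) E)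
        (upward⇒exact 𝓘L 𝓘H τ-in τ-out ω)
  , mk⇔ to from
  where
  open MarkovCategory 𝓒

  Exact = IsExactTransformation 𝓒 𝓘L 𝓘H τ-in τ-out ω
  Upward = IsUpwardAbstraction 𝓒 (ioModel 𝓘L) (ioModel 𝓘H) U ioπ (ioτ 𝓘L 𝓘H τ-in τ-out) ω
  AllEpic = ∀ Xs → Epic (extend 𝓒 (ioModel 𝓘L) (ioModel 𝓘H) ioπ (ioτ 𝓘L 𝓘H τ-in τ-out) Xs)

  to : Exact × AllEpic → Upward
  to (E , epic) = exact⇒upward 𝓘L 𝓘H τ-in τ-out ω (λ Xs _ → epic Xs) E

  from : Upward → Exact × AllEpic
  -- The final `_` is the trivial proof that `Xs` lies in `U`.
  from A = upward⇒exact 𝓘L 𝓘H τ-in τ-out ω A , λ Xs → IsUpwardAbstraction.products-epic A Xs _
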